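{- Let $\Psi$ be a Turing functional. There is a computable coloring $c:[\omega]^2\to 2$ such that for every $k\geq 2$, every stable coloring $d:[\omega]^2\to k$ has an infinite limit-homogeneous set $L$ with the property that $\Psi^L$ is not equal to (the characteristic function of) any infinite homogeneous set for $c$.
   Context: $[X]^2$ is the set of two-element subsets of $X$, and $k=\{0,\ldots,k-1\}$. A coloring $d:[\omega]^2\to k$ is stable if for every $x$ the limit $\lim_y d(x,y)$ exists. A set $H$ is homogeneous for $c$ if $c$ is constant on $[H]^2$. A set $L$ is limit-homogeneous for a stable coloring $d$ if there is $j<k$ with $\lim_y d(x,y)=j$ for all $x\in L$. -}

module Defs where

open import Data.Nat using (ℕ; zero; suc; _<_; _≤_)
open import Data.Fin using (Fin; toℕ)
open import Data.Vec using (Vec; []; _∷_; lookup)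
open import Data.Bool using (Bool; true; false; if_then_else_)
open import Data.Maybe using (Maybe; just; nothing; _>>=_)
open import Data.Product using (Σ; ∃; ∃-syntax; _×_; _,_)
open import Relation.Binary.PropositionalEquality using (_≡_)
open import Relation.Nullary using (¬_)

-- A model of computation with an oracle: codes for oracle
-- partial recursive (mu-recursive) functions of a given arity.
-- The oracle is a set of naturals, given by its characteristic
-- function ℕ → Bool; the basic function `orc` returns χ_O(x) ∈ {0,1}.

data Code : ℕ → Set where
  zer  : ∀ {n} → Code n
  succ : Code 1
  proj : ∀ {n} → Fin n → Code n
  orc  : Code 1
  comp : ∀ {m n} → Code m → Vec (Code n) m → Code n
  prec : ∀ {n} → Code n → Code (suc (suc n)) → Code (suc n)
  mu   : ∀ {n} → Code (suc n) → Code n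

-- Fuel-bounded evaluation (fuel also bounds the length of unbounded searches).
mutual
  eval : ℕ → (ℕ → Bool) → ∀ {n} → Code n → Vec ℕ n → Maybe ℕ
  eval zero    O c xs = nothing
  eval (suc f) O zer xs = just 0
  eval (suc f) O succ (x ∷ []) = just (suc x)
  eval (suc f) O (proj i) xs = just (lookup xs i)
  eval (suc f) O orc (x ∷ []) = just (if O x then 1 else 0)
  eval (suc f) O (comp g hs) xs = evalVec f O hs xs >>= λ ys → eval f O g ys
  eval (suc f) O (prec g h) (zero ∷ xs) = eval f O g xs
  eval (suc f) O (prec g h) (suc n ∷ xs) =
    eval f O (prec g h) (n ∷ xs) >>= λ r → eval f O h (n ∷ r ∷ xs)
  eval (suc f) O (mu g) xs = search f O g xs f 0

  evalVec : ℕ → (ℕ → Bool) → ∀ {m n} → Vec (Code n) m → Vec ℕ n → Maybe (Vec ℕ m)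
  evalVec f O [] xs = just []
  evalVec f O (h ∷ hs) xs =
    eval f O h xs >>= λ y → evalVec f O hs xs >>= λ ys → just (y ∷ ys)

  search : ℕ → (ℕ → Bool) → ∀ {n} → Code (suc n) → Vec ℕ n → ℕ → ℕ → Maybe ℕ
  search f O g xs zero i = nothing
  search f O g xs (suc b) i with eval f O g (i ∷ xs)
  ... | nothing = nothing
  ... | just zero = just i
  ... | just (suc _) = search f O g xs b (suc i)

TuringFunctional : Set
TuringFunctional = Code 1

_^_⟨_⟩↓=_ : ∀ {n} → Code n → (ℕ → Bool) → Vec ℕ n → ℕ → Set
Φ ^ O ⟨ xs ⟩↓= v = ∃[ s ] (eval s O Φ xs ≡ just v)

-- Sets of naturals and colorings of [ω]^2.
-- A set is its characteristic function ℕ → Bool.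
-- A coloring [ω]^2 → k is a function d : ℕ → ℕ → Fin k, of which only
-- the values d x y with x < y are relevant (d(x,y) for {x<y}).

Coloring : ℕ → Set
Coloring k = ℕ → ℕ → Fin k

χ : (ℕ → Bool) → ℕ → ℕ
χ H x = if H x then 1 else 0

Infinite : (ℕ → Bool) → Set
Infinite H = ∀ n → ∃[ m ] (n ≤ m × H m ≡ true)

ComputableColoring : ∀ {k} → Coloring k → Set
ComputableColoring c =
  ∃[ e ] (∀ x y → x < y → (e ^ (λ _ → false) ⟨ x ∷ y ∷ [] ⟩↓= toℕ (c x y)))

LimitIs : ∀ {k} → Coloring k → ℕ → Fin k → Set
LimitIs d x j = ∃[ m ] (∀ y → m < y → d x y ≡ j)

Stable : ∀ {k} → Coloring k → Set
Stable {k} d = ∀ x → ∃[ j ] LimitIs d x j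

Homogeneous : ∀ {k} → Coloring k → (ℕ → Bool) → Set
Homogeneous {k} c H =
  ∃[ i ] (∀ x y → x < y → H x ≡ true → H y ≡ true → c x y ≡ i)

LimitHomogeneous : ∀ {k} → Coloring k → (ℕ → Bool) → Set
LimitHomogeneous {k} d L = ∃[ j ] (∀ x → L x ≡ true → LimitIs d x j)

ComputesChar : TuringFunctional → (ℕ → Bool) → (ℕ → Bool) → Set
ComputesChar Ψ L H = ∀ x → Ψ ^ L ⟨ x ∷ [] ⟩↓= χ H x

ExcludedMiddle : Set₁
ExcludedMiddle = (P : Set) → P ⊎' ¬ P
  where
  open import Data.Sum using () renaming (_⊎_ to _⊎'_)

{-# OPTIONS --safe #-}
module Submission where

-- Cut ω into consecutive blocks and colour x < y by 1 iff they lie in the same block, so that an infinite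
-- homogeneous set has at most one element in each block. A block starting at b is closed at the first N > b
-- such that, for every colouring of [b, N) with b + 2 colours, some subset F of a colour class makes Ψ^F accept
-- two elements of [b, N) within N steps.
-- If there are infinitely many blocks, consider one that starts beyond k and beyond the finite limit-colour
-- classes of d: the set F it provides for the limit colours of d, continued beyond the use of the two
-- computations inside the (infinite) class of F, is the required L.
-- If the last block is never closed, König's lemma yields a colouring of ω no class of which contains such an F.
-- One of its classes meets a limit-colour class of d in an infinite set L, and Ψ^L has at most one element ≥ b.

open import Defs
open import Data.Bool using (Bool; true; false; if_then_else_; _∧_; _∨_; not; T)
open import Data.Bool.Properties using (T-∧; T-∨; T?; T-≡; ∧-identityʳ) renaming (_≟_ to _≟ᵇ_)
open import Data.Empty using (⊥; ⊥-elim)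
open import Data.Fin using (Fin; zero; suc; toℕ; #_)
open import Data.Fin.Properties using (toℕ-injective; toℕ<n)
open import Data.Maybe using (Maybe; just; nothing; _>>=_)
open import Data.Maybe.Properties using (just-injective)
open import Data.Nat using (ℕ; zero; suc; pred; _+_; _*_; _∸_; _≤_; _<_; _≥_; _⊔_; z≤n; s≤s; s≤s⁻¹; z<s;
  _<ᵇ_; _≡ᵇ_; _<?_; _≤?_; _≟_)
open import Data.Nat.Properties
open import Data.Product using (∃-syntax; _×_; _,_; proj₁; proj₂)
open import Data.Sum using (_⊎_; inj₁; inj₂; [_,_]′)
open import Data.Unit using (tt)
open import Data.Vec using (Vec; []; _∷_; lookup; head; tail; tabulate)
open import Function using (_∘_; Equivalence)
open import Relation.Binary.PropositionalEquality
open import Relation.Nullary using (¬_; yes; no; does; contradiction)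
open import Relation.Nullary.Decidable using (_×-dec_; _⊎-dec_; dec-true)
open import Relation.Unary using (Decidable)

open Equivalence using (to; from)

-- Evaluation with bounded searches

Oracle : Set
Oracle = ℕ → Bool

natrec : {A : Set} → ℕ → A → (ℕ → A → A) → A
natrec zero    z f = z
natrec (suc n) z f = f n (natrec n z f)

-- States of an unbounded search: 0 is "diverged", 1 is "no zero so far", 2 + i is "least zero at i".
verdict : ℕ → Maybe ℕ → ℕ
verdict i nothing        = 0
verdict i (just zero)    = suc (suc i)
verdict i (just (suc _)) = 1

scanStep : ℕ → ℕ → Maybe ℕ → ℕ
scanStep i zero          m = 0
scanStep i (suc zero)    m = verdict i m
scanStep i (suc (suc v)) m = suc (suc v)

found : ℕ → Maybe ℕ
found zero          = nothing
found (suc zero)    = nothing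
found (suc (suc v)) = just v

-- Unlike in eval, the bound s limits only the length of unbounded searches, so that ev is structurally
-- recursive in the code and, for a fixed code, primitive recursive in its other arguments.
mutual
  ev : ℕ → Oracle → ∀ {n} → Code n → Vec ℕ n → Maybe ℕ
  ev s O zer xs               = just 0
  ev s O succ (x ∷ [])        = just (suc x)
  ev s O (proj i) xs          = just (lookup xs i)
  ev s O orc (x ∷ [])         = just (if O x then 1 else 0)
  ev s O (comp g hs) xs       = evs s O hs xs >>= λ ys → ev s O g ys
  ev s O (prec g h) (n ∷ xs)  = natrec n (ev s O g xs) λ i r → r >>= λ v → ev s O h (i ∷ v ∷ xs)
  ev s O (mu g) xs            = found (scan s O g xs s)

  evs : ℕ → Oracle → ∀ {m n} → Vec (Code n) m → Vec ℕ n → Maybe (Vec ℕ m)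
  evs s O []       xs = just []
  evs s O (h ∷ hs) xs = ev s O h xs >>= λ y → evs s O hs xs >>= λ ys → just (y ∷ ys)

  scan : ℕ → Oracle → ∀ {n} → Code (suc n) → Vec ℕ n → ℕ → ℕ
  scan s O g xs k = natrec k 1 λ i r → scanStep i r (ev s O g (i ∷ xs))

-- Monotonicity in the fuel, and soundness of bounded-search evaluation.

>>=-inv : {A B : Set} (m : Maybe A) {k : A → Maybe B} {v : B} →
  (m >>= k) ≡ just v → ∃[ y ] (m ≡ just y × k y ≡ just v)
>>=-inv (just y) p = y , refl , p

mutual
  eval-mono : ∀ {f f′} O {n} (c : Code n) xs {v} → f ≤ f′ → eval f O c xs ≡ just v → eval f′ O c xs ≡ just v
  eval-mono O zer xs (s≤s f≤) p = p
  eval-mono O succ (x ∷ []) (s≤s f≤) p = p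
  eval-mono O (proj i) xs (s≤s f≤) p = p
  eval-mono O orc (x ∷ []) (s≤s f≤) p = p
  eval-mono {suc f} O (comp g hs) xs (s≤s f≤) p with >>=-inv (evalVec f O hs xs) p
  ... | ys , q , r rewrite evalVec-mono O hs xs f≤ q = eval-mono O g ys f≤ r
  eval-mono O (prec g h) (zero ∷ xs) (s≤s f≤) p = eval-mono O g xs f≤ p
  eval-mono {suc f} O (prec g h) (suc n ∷ xs) (s≤s f≤) p with >>=-inv (eval f O (prec g h) (n ∷ xs)) p
  ... | y , q , r rewrite eval-mono O (prec g h) (n ∷ xs) f≤ q = eval-mono O h (n ∷ y ∷ xs) f≤ r
  eval-mono O (mu g) xs (s≤s f≤) p = search-mono O g xs 0 f≤ f≤ p

  evalVec-mono : ∀ {f f′} O {m n} (hs : Vec (Code n) m) xs {v} → f ≤ f′ →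
    evalVec f O hs xs ≡ just v → evalVec f′ O hs xs ≡ just v
  evalVec-mono O [] xs f≤ p = p
  evalVec-mono {f} O (h ∷ hs) xs f≤ p with >>=-inv (eval f O h xs) p
  ... | y , q , r with >>=-inv (evalVec f O hs xs) r
  ... | ys , q′ , refl rewrite eval-mono O h xs f≤ q | evalVec-mono O hs xs f≤ q′ = refl

  search-mono : ∀ {f f′} O {n} (g : Code (suc n)) xs {b b′} i {v} → f ≤ f′ → b ≤ b′ →
    search f O g xs b i ≡ just v → search f′ O g xs b′ i ≡ just v
  search-mono {f} O g xs {suc b} i f≤ (s≤s b≤) p with eval f O g (i ∷ xs) in e
  ... | just zero    rewrite eval-mono O g (i ∷ xs) f≤ e = p
  ... | just (suc _) rewrite eval-mono O g (i ∷ xs) f≤ e = search-mono O g xs (suc i) f≤ b≤ p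

private
  -- A search runs one computation per candidate; by monotonicity the maximum of their fuels serves
  -- them all.
  uniform-bound : {P : ℕ → ℕ → Set} → (∀ {i f f′} → f ≤ f′ → P i f → P i f′) →
    ∀ v → (∀ i → i < v → ∃[ f ] P i f) → ∃[ f ] (∀ i → i < v → P i f)
  uniform-bound mono zero    h = 0 , λ i ()
  uniform-bound {P} mono (suc v) h with uniform-bound {P} mono v (λ i i<v → h i (m<n⇒m<1+n i<v)) | h v (n<1+n v)
  ... | f , p | f′ , p′ = f ⊔ f′ , go
    where
    go : ∀ i → i < suc v → P i (f ⊔ f′)
    go i (s≤s i≤v) with m≤n⇒m<n∨m≡n i≤v
    ... | inj₁ i<v  = mono (m≤m⊔n f f′) (p i i<v)
    ... | inj₂ refl = mono (m≤n⊔m f f′) p′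

scan-one : ∀ s O {n} (g : Code (suc n)) xs k → scan s O g xs k ≡ 1 →
  ∀ i → i < k → ∃[ w ] (ev s O g (i ∷ xs) ≡ just (suc w))
scan-one s O g xs (suc k) p i (s≤s i≤k) with scan s O g xs k in e
... | suc zero with ev s O g (k ∷ xs) in e′
...   | just (suc w) with m≤n⇒m<n∨m≡n i≤k
...     | inj₁ i<k  = scan-one s O g xs k e i i<k
...     | inj₂ refl = w , e′

scan-found : ∀ s O {n} (g : Code (suc n)) xs k {v} → scan s O g xs k ≡ suc (suc v) →
  scan s O g xs v ≡ 1 × ev s O g (v ∷ xs) ≡ just 0
scan-found s O g xs (suc k) p with scan s O g xs k in e
scan-found s O g xs (suc k) p | suc zero with ev s O g (k ∷ xs) in e′
scan-found s O g xs (suc k) refl | suc zero | just zero = e , e′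
scan-found s O g xs (suc k) refl | suc (suc v) = scan-found s O g xs k e

scan-stays : ∀ s O {n} (g : Code (suc n)) xs {v k k′} → k ≤ k′ →
  scan s O g xs k ≡ suc (suc v) → scan s O g xs k′ ≡ suc (suc v)
scan-stays s O g xs {k′ = zero}   z≤n p = p
scan-stays s O g xs {k′ = suc k′} k≤ p with m≤n⇒m<n∨m≡n k≤
... | inj₂ refl = p
... | inj₁ (s≤s k≤k′) rewrite scan-stays s O g xs k≤k′ p = refl

-- Induction on the distance `d` from the current candidate `i` to the zero `v`. The budget `b` must
-- exceed `d`, since testing `v` itself costs one more try.
search-complete : ∀ f O {n} (g : Code (suc n)) xs v →
  (∀ i → i < v → ∃[ w ] (eval f O g (i ∷ xs) ≡ just (suc w))) → eval f O g (v ∷ xs) ≡ just 0 →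
  ∀ d b i → d < b → i + d ≡ v → search f O g xs b i ≡ just v
search-complete f O g xs v pos z zero (suc b) i _ refl rewrite +-identityʳ i | z = refl
search-complete f O g xs v pos z (suc d) (suc b) i (s≤s d<b) e
  with pos i (subst (i <_) e (m<m+n i z<s))
... | w , q rewrite q = search-complete f O g xs v pos z d b (suc i) d<b (trans (sym (+-suc i d)) e)

mutual
  -- A convergent `ev` computation has finitely many subcomputations, so the maximum of their fuels,
  -- plus one for the outer constructor, is enough for `eval`.
  ev-sound : ∀ s O {n} (c : Code n) xs {v} → ev s O c xs ≡ just v → ∃[ f ] (eval f O c xs ≡ just v)
  ev-sound s O zer xs p = 1 , p
  ev-sound s O succ (x ∷ []) p = 1 , p
  ev-sound s O (proj i) xs p = 1 , p
  ev-sound s O orc (x ∷ []) p = 1 , p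
  ev-sound s O (comp g hs) xs p with >>=-inv (evs s O hs xs) p
  ... | ys , q , r with evs-sound s O hs xs q | ev-sound s O g ys r
  ... | f , q′ | f′ , r′ = suc (f ⊔ f′) , lem
    where
    lem : eval (suc (f ⊔ f′)) O (comp g hs) xs ≡ _
    lem rewrite evalVec-mono O hs xs (m≤m⊔n f f′) q′ = eval-mono O g ys (m≤n⊔m f f′) r′
  ev-sound s O (prec g h) (n ∷ xs) p = prec-sound s O g h n xs p
  ev-sound s O (mu g) xs p = mu-sound s O g xs p

  mu-sound : ∀ s O {n} (g : Code (suc n)) xs {v} → found (scan s O g xs s) ≡ just v →
    ∃[ f ] (eval f O (mu g) xs ≡ just v)
  mu-sound s O g xs p with scan s O g xs s in e
  mu-sound s O g xs {v} refl | suc (suc _) with scan-found s O g xs s e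
  ... | one , zero? with ev-sound s O g (v ∷ xs) zero?
  ... | f₀ , z with uniform-bound {λ i f → ∃[ w ] (eval f O g (i ∷ xs) ≡ just (suc w))}
                      (λ {i} f≤ (w , q) → w , eval-mono O g (i ∷ xs) f≤ q) v
                      (λ i i<v → let w , q = scan-one s O g xs v one i i<v
                                     f , q′ = ev-sound s O g (i ∷ xs) q in f , w , q′)
  ... | f₁ , pos = suc F , search-complete F O g xs v
                      (λ i i<v → let w , q = pos i i<v in
                        w , eval-mono O g (i ∷ xs) (≤-trans (m≤n⊔m f₀ f₁) (m≤m⊔n _ _)) q)
                      (eval-mono O g (v ∷ xs) (≤-trans (m≤m⊔n f₀ f₁) (m≤m⊔n _ _)) z)
                      -- `eval` uses one number both as fuel and as search budget, so `F` has to
                      -- dominate the fuels of all tests as well as the `suc v` tries.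
                      v F 0 (m≤n⊔m (f₀ ⊔ f₁) (suc v)) refl
    where
    F : ℕ
    F = (f₀ ⊔ f₁) ⊔ suc v

  prec-sound : ∀ s O {n} (g : Code n) h k xs {v} → ev s O (prec g h) (k ∷ xs) ≡ just v →
    ∃[ f ] (eval f O (prec g h) (k ∷ xs) ≡ just v)
  prec-sound s O g h zero xs p with ev-sound s O g xs p
  ... | f , q = suc f , q
  prec-sound s O g h (suc k) xs p with >>=-inv (ev s O (prec g h) (k ∷ xs)) p
  ... | y , q , r with prec-sound s O g h k xs q | ev-sound s O h (k ∷ y ∷ xs) r
  ... | f , q′ | f′ , r′ = suc (f ⊔ f′) , lem
    where
    lem : eval (suc (f ⊔ f′)) O (prec g h) (suc k ∷ xs) ≡ _
    lem rewrite eval-mono O (prec g h) (k ∷ xs) (m≤m⊔n f f′) q′ = eval-mono O h _ (m≤n⊔m f f′) r′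

  evs-sound : ∀ s O {m n} (hs : Vec (Code n) m) xs {ys} → evs s O hs xs ≡ just ys →
    ∃[ f ] (evalVec f O hs xs ≡ just ys)
  evs-sound s O [] xs p = 0 , p
  evs-sound s O (h ∷ hs) xs p with >>=-inv (ev s O h xs) p
  ... | y , q , r with >>=-inv (evs s O hs xs) r
  ... | ys , r′ , refl with ev-sound s O h xs q | evs-sound s O hs xs r′
  ... | f , q₁ | f′ , r₁ = f ⊔ f′ , lem
    where
    lem : evalVec (f ⊔ f′) O (h ∷ hs) xs ≡ just (y ∷ ys)
    lem rewrite eval-mono O h xs (m≤m⊔n f f′) q₁ | evalVec-mono O hs xs (m≤n⊔m f f′) r₁ = refl

-- The use principle: completeness of bounded-search evaluation.

AgreeBelow : {A : Set} → ℕ → (ℕ → A) → (ℕ → A) → Set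
AgreeBelow u a b = ∀ {y} → y < u → a y ≡ b y

agree-≤ : {A : Set} {u u′ : ℕ} {a b : ℕ → A} → u ≤ u′ → AgreeBelow u′ a b → AgreeBelow u a b
agree-≤ u≤ ag y<u = ag (<-≤-trans y<u u≤)

-- A single threshold `u` plays two roles: it is a lower bound for the search bound and the use of
-- the computation, below which the oracle must be preserved.
Eventually : Oracle → (ℕ → Oracle → Set) → Set
Eventually O P = ∃[ u ] (∀ s O′ → u ≤ s → AgreeBelow u O O′ → P s O′)

eventually-map₂ : ∀ {O P Q R} → (∀ {s O′} → P s O′ → Q s O′ → R s O′) →
  Eventually O P → Eventually O Q → Eventually O R
eventually-map₂ F (u , p) (u′ , q) = u ⊔ u′ , λ s O′ u≤s ag →
  F (p s O′ (≤-trans (m≤m⊔n u u′) u≤s) (agree-≤ {b = O′} (m≤m⊔n u u′) ag))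
    (q s O′ (≤-trans (m≤n⊔m u u′) u≤s) (agree-≤ {b = O′} (m≤n⊔m u u′) ag))

mutual
  -- A halting computation makes finitely many oracle queries and finitely many search steps; the
  -- threshold exceeds all of them. A query at `x` contributes `suc x`.
  ev-complete : ∀ f O {n} (c : Code n) xs {v} → eval f O c xs ≡ just v →
    Eventually O λ s O′ → ev s O′ c xs ≡ just v
  ev-complete (suc f) O zer xs p = 0 , λ _ _ _ _ → p
  ev-complete (suc f) O succ (x ∷ []) p = 0 , λ _ _ _ _ → p
  ev-complete (suc f) O (proj i) xs p = 0 , λ _ _ _ _ → p
  ev-complete (suc f) O orc (x ∷ []) p =
    suc x , λ s O′ _ ag → trans (cong (λ b → just (if b then 1 else 0)) (sym (ag (n<1+n x)))) p
  ev-complete (suc f) O (comp g hs) xs p with >>=-inv (evalVec f O hs xs) p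
  ... | ys , q , r = eventually-map₂ (λ e e′ → trans (cong (_>>= _) e) e′)
                       (evs-complete f O hs xs q) (ev-complete f O g ys r)
  ev-complete (suc f) O (prec g h) (zero ∷ xs) p = ev-complete f O g xs p
  ev-complete (suc f) O (prec g h) (suc k ∷ xs) p with >>=-inv (eval f O (prec g h) (k ∷ xs)) p
  ... | y , q , r = eventually-map₂ (λ e e′ → trans (cong (_>>= _) e) e′)
                      (ev-complete f O (prec g h) (k ∷ xs) q) (ev-complete f O h (k ∷ y ∷ xs) r)
  ev-complete (suc f) O (mu g) xs {v} p =
    eventually-map₂ (λ {s} {O′} v<s e → cong found (scan-stays s O′ g xs v<s (e refl)))
      (suc v , λ _ _ v<s _ → v<s) (search-scan f O g xs f 0 p)

  evs-complete : ∀ f O {m n} (hs : Vec (Code n) m) xs {ys} → evalVec f O hs xs ≡ just ys →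
    Eventually O λ s O′ → evs s O′ hs xs ≡ just ys
  evs-complete f O [] xs p = 0 , λ _ _ _ _ → p
  evs-complete f O (h ∷ hs) xs p with >>=-inv (eval f O h xs) p
  ... | y , q , r with >>=-inv (evalVec f O hs xs) r
  ... | ys , r′ , refl = eventually-map₂
          (λ e e′ → trans (cong (_>>= _) e) (cong (_>>= _) e′))
          (ev-complete f O h xs q) (evs-complete f O hs xs r′)

  -- `search` starts at an arbitrary candidate `i`, whereas `scan` always starts at 0. The premise
  -- that the scan is still in state 1 at `i` connects the two.
  search-scan : ∀ f O {n} (g : Code (suc n)) xs b i {v} → search f O g xs b i ≡ just v →
    Eventually O λ s O′ → scan s O′ g xs i ≡ 1 → scan s O′ g xs (suc v) ≡ suc (suc v)
  search-scan f O g xs (suc b) i p with eval f O g (i ∷ xs) in e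
  search-scan f O g xs (suc b) i refl | just zero with ev-complete f O g (i ∷ xs) e
  ... | u , h = u , λ s O′ u≤s ag one → cong₂ (scanStep i) one (h s O′ u≤s ag)
  search-scan f O g xs (suc b) i p | just (suc _) = eventually-map₂
    (λ e₁ e₂ one → e₂ (cong₂ (scanStep i) one e₁))
    (ev-complete f O g (i ∷ xs) e) (search-scan f O g xs b (suc i) p)

-- Both computations are replayed under a common search bound with the oracle `O′`, where `ev` has
-- only one value.
eventually-unique : ∀ {O O′ n} (c : Code n) xs {v w} (U : Eventually O λ s O″ → ev s O″ c xs ≡ just v) →
  AgreeBelow (proj₁ U) O O′ → c ^ O′ ⟨ xs ⟩↓= w → v ≡ w
eventually-unique {O′ = O′} c xs (u , h) ag (f , p) with ev-complete f O′ c xs p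
... | u′ , h′ = just-injective
  (trans (sym (h (u ⊔ u′) O′ (m≤m⊔n u u′) ag)) (h′ (u ⊔ u′) O′ (m≤n⊔m u u′) λ _ → refl))

-- Primitive recursive functions as codes

-- Correctness is demanded for every search bound and every oracle, so such a code converges already
-- with bound 0 and relative to the empty set.
record PrimRec {n} (f : Vec ℕ n → ℕ) : Set where
  constructor primRec
  field
    code    : Code n
    correct : ∀ s O xs → ev s O code xs ≡ just (f xs)
open PrimRec

record PrimRecVec {n m} (as : Vec ℕ n → Vec ℕ m) : Set where
  constructor primRecVec
  field component : ∀ i → PrimRec λ xs → lookup (as xs) i
open PrimRecVec

bit : Bool → ℕ
bit b = if b then 1 else 0

record PrimRecᵇ {n} (P : Vec ℕ n → Bool) : Set where
  constructor primRecᵇ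
  field indicator : PrimRec λ xs → bit (P xs)
open PrimRecᵇ

caseℕ : ℕ → ℕ → (ℕ → ℕ) → ℕ
caseℕ n z f = natrec n z λ i _ → f i

any< : ℕ → (ℕ → Bool) → Bool
any< n P = natrec n false λ i b → b ∨ P i

all< : ℕ → (ℕ → Bool) → Bool
all< n P = natrec n true λ i b → b ∧ P i

evs-tabulate : ∀ s O {m n} (e : Fin m → Code n) xs ys → (∀ i → ev s O (e i) xs ≡ just (lookup ys i)) →
  evs s O (tabulate e) xs ≡ just ys
evs-tabulate s O e xs [] h = refl
evs-tabulate s O e xs (y ∷ ys) h
  rewrite h zero | evs-tabulate s O (e ∘ suc) xs ys (h ∘ suc) = refl

private variable
  k m n : ℕ

pr-ext : {f g : Vec ℕ n → ℕ} → (∀ xs → f xs ≡ g xs) → PrimRec f → PrimRec g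
pr-ext f≗g (primRec e ok) = primRec e λ s O xs → trans (ok s O xs) (cong just (f≗g xs))

prᵇ-ext : {P Q : Vec ℕ n → Bool} → (∀ xs → P xs ≡ Q xs) → PrimRecᵇ P → PrimRecᵇ Q
prᵇ-ext P≗Q (primRecᵇ p) = primRecᵇ (pr-ext (λ xs → cong bit (P≗Q xs)) p)

pr-∘ : {f : Vec ℕ m → ℕ} {as : Vec ℕ n → Vec ℕ m} → PrimRec f → PrimRecVec as → PrimRec λ xs → f (as xs)
pr-∘ {as = as} (primRec e ok) (primRecVec ps) = primRec (comp e (tabulate (code ∘ ps))) λ s O xs →
  trans (cong (_>>= _) (evs-tabulate s O (code ∘ ps) xs (as xs) λ i → correct (ps i) s O xs)) (ok s O (as xs))

prᵇ-∘ : {P : Vec ℕ m → Bool} {as : Vec ℕ n → Vec ℕ m} → PrimRecᵇ P → PrimRecVec as → PrimRecᵇ λ xs → P (as xs)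
prᵇ-∘ (primRecᵇ p) ps = primRecᵇ (pr-∘ p ps)

pr-var : ∀ (i : Fin n) → PrimRec λ xs → lookup xs i
pr-var i = primRec (proj i) λ s O xs → refl

pr-id : PrimRecVec {n} λ xs → xs
pr-id = primRecVec pr-var

pr-[] : PrimRecVec {n} λ xs → []
pr-[] = primRecVec λ ()

infixr 5 _∷ᵖ_
_∷ᵖ_ : {a : Vec ℕ n → ℕ} {as : Vec ℕ n → Vec ℕ m} → PrimRec a → PrimRecVec as → PrimRecVec λ xs → a xs ∷ as xs
component (p ∷ᵖ ps) zero    = p
component (p ∷ᵖ ps) (suc i) = component ps i

pr-head : {as : Vec ℕ n → Vec ℕ (suc m)} → PrimRecVec as → PrimRec λ xs → head (as xs)
pr-head {as = as} ps = pr-ext (λ xs → lookup-zero (as xs)) (component ps zero)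
  where
  lookup-zero : ∀ {m} (ys : Vec ℕ (suc m)) → lookup ys zero ≡ head ys
  lookup-zero (y ∷ ys) = refl

pr-tail : {as : Vec ℕ n → Vec ℕ (suc m)} → PrimRecVec as → PrimRecVec λ xs → tail (as xs)
component (pr-tail {as = as} ps) i = pr-ext (λ xs → lookup-suc (as xs)) (component ps (suc i))
  where
  lookup-suc : ∀ {m} {i : Fin m} (ys : Vec ℕ (suc m)) → lookup ys (suc i) ≡ lookup (tail ys) i
  lookup-suc (y ∷ ys) = refl

pr-vec-∘ : {as : Vec ℕ n → Vec ℕ m} {bs : Vec ℕ k → Vec ℕ n} → PrimRecVec as → PrimRecVec bs →
  PrimRecVec λ xs → as (bs xs)
pr-vec-∘ ps qs = primRecVec λ i → pr-∘ (component ps i) qs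

pr-zero : PrimRec {n} λ xs → 0
pr-zero = primRec zer λ s O xs → refl

pr-suc : {a : Vec ℕ n → ℕ} → PrimRec a → PrimRec λ xs → suc (a xs)
pr-suc p = pr-∘ {f = λ ys → suc (head ys)} (primRec succ λ { s O (x ∷ []) → refl }) (p ∷ᵖ pr-[])

pr-natrec : {a z : Vec ℕ n → ℕ} {f : Vec ℕ (2 + n) → ℕ} → PrimRec a → PrimRec z → PrimRec f →
  PrimRec λ xs → natrec (a xs) (z xs) λ i r → f (i ∷ r ∷ xs)
pr-natrec {n} {z = z} {f} p (primRec ez okz) (primRec ef okf) = pr-∘ (primRec (prec ez ef) ok) (p ∷ᵖ pr-id)
  where
  rec : ℕ → Vec ℕ n → ℕ
  rec k xs = natrec k (z xs) λ i r → f (i ∷ r ∷ xs)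
  go : ∀ s O k xs → ev s O (prec ez ef) (k ∷ xs) ≡ just (rec k xs)
  go s O zero    xs = okz s O xs
  go s O (suc k) xs = trans (cong (_>>= _) (go s O k xs)) (okf s O (k ∷ rec k xs ∷ xs))
  ok : ∀ s O ys → ev s O (prec ez ef) ys ≡ just (rec (head ys) (tail ys))
  ok s O (k ∷ xs) = go s O k xs

pr-case : {a z : Vec ℕ n → ℕ} {f : Vec ℕ (1 + n) → ℕ} → PrimRec a → PrimRec z → PrimRec f →
  PrimRec λ xs → caseℕ (a xs) (z xs) λ i → f (i ∷ xs)
pr-case p q r = pr-natrec p q (pr-∘ r (pr-head pr-id ∷ᵖ pr-tail (pr-tail pr-id)))

pr-lift : {f : Vec ℕ n → ℕ} → PrimRec f → PrimRec {suc n} λ xs → f (tail xs)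
pr-lift p = pr-∘ p (pr-tail pr-id)

pr-if : {P : Vec ℕ n → Bool} {f g : Vec ℕ n → ℕ} → PrimRecᵇ P → PrimRec f → PrimRec g →
  PrimRec λ xs → if P xs then f xs else g xs
pr-if {P = P} (primRecᵇ p) q r = pr-ext (λ xs → lem (P xs)) (pr-case p r (pr-lift q))
  where
  lem : ∀ b {x y} → caseℕ (bit b) y (λ _ → x) ≡ (if b then x else y)
  lem true  = refl
  lem false = refl

prᵇ-if : {P Q R : Vec ℕ n → Bool} → PrimRecᵇ P → PrimRecᵇ Q → PrimRecᵇ R →
  PrimRecᵇ λ xs → if P xs then Q xs else R xs
prᵇ-if {P = P} p q r = primRecᵇ (pr-ext (λ xs → lem (P xs)) (pr-if p (indicator q) (indicator r)))
  where
  lem : ∀ b {x y} → (if b then bit x else bit y) ≡ bit (if b then x else y)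
  lem true  = refl
  lem false = refl

prᵇ-const : ∀ b → PrimRecᵇ {n} λ xs → b
prᵇ-const true  = primRecᵇ (pr-suc pr-zero)
prᵇ-const false = primRecᵇ pr-zero

prᵇ-∧ : {P Q : Vec ℕ n → Bool} → PrimRecᵇ P → PrimRecᵇ Q → PrimRecᵇ λ xs → P xs ∧ Q xs
prᵇ-∧ {P = P} p q = prᵇ-ext (λ xs → lem (P xs)) (prᵇ-if p q (prᵇ-const false))
  where
  lem : ∀ b {x} → (if b then x else false) ≡ b ∧ x
  lem true  = refl
  lem false = refl

prᵇ-∨ : {P Q : Vec ℕ n → Bool} → PrimRecᵇ P → PrimRecᵇ Q → PrimRecᵇ λ xs → P xs ∨ Q xs
prᵇ-∨ {P = P} p q = prᵇ-ext (λ xs → lem (P xs)) (prᵇ-if p (prᵇ-const true) q)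
  where
  lem : ∀ b {x} → (if b then true else x) ≡ b ∨ x
  lem true  = refl
  lem false = refl

prᵇ-not : {P : Vec ℕ n → Bool} → PrimRecᵇ P → PrimRecᵇ λ xs → not (P xs)
prᵇ-not {P = P} p = prᵇ-ext (λ xs → lem (P xs)) (prᵇ-if p (prᵇ-const false) (prᵇ-const true))
  where
  lem : ∀ b → (if b then false else true) ≡ not b
  lem true  = refl
  lem false = refl

prᵇ-pos : {a : Vec ℕ n → ℕ} → PrimRec a → PrimRecᵇ λ xs → 0 <ᵇ a xs
prᵇ-pos {a = a} p = primRecᵇ (pr-ext (λ xs → lem (a xs)) (pr-case p pr-zero (pr-suc pr-zero)))
  where
  lem : ∀ x → caseℕ x 0 (λ _ → 1) ≡ bit (0 <ᵇ x)
  lem zero    = refl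
  lem (suc x) = refl

prᵇ-natrec : {a : Vec ℕ n → ℕ} {z : Vec ℕ n → Bool} {P : Vec ℕ (2 + n) → Bool} → PrimRec a → PrimRecᵇ z →
  PrimRecᵇ P → PrimRecᵇ λ xs → natrec (a xs) (z xs) λ i b → P (i ∷ bit b ∷ xs)
prᵇ-natrec {a = a} {z} {P} p (primRecᵇ q) (primRecᵇ r) = primRecᵇ (pr-ext (λ xs → lem xs (a xs)) (pr-natrec p q r))
  where
  lem : ∀ xs k → natrec k (bit (z xs)) (λ i r → bit (P (i ∷ r ∷ xs))) ≡
                 bit (natrec k (z xs) λ i b → P (i ∷ bit b ∷ xs))
  lem xs zero    = refl
  lem xs (suc k) = cong (λ r → bit (P (k ∷ r ∷ xs))) (lem xs k)

private
  pos-bit : ∀ b → (0 <ᵇ bit b) ≡ b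
  pos-bit true  = refl
  pos-bit false = refl

  natrec-cong : {A : Set} {f g : ℕ → A → A} → (∀ i r → f i r ≡ g i r) → ∀ n {z} → natrec n z f ≡ natrec n z g
  natrec-cong f≗g zero    = refl
  natrec-cong {f = f} f≗g (suc n) = trans (cong (f n) (natrec-cong f≗g n)) (f≗g n _)

prᵇ-any : {a : Vec ℕ n → ℕ} {P : Vec ℕ (1 + n) → Bool} → PrimRec a → PrimRecᵇ P →
  PrimRecᵇ λ xs → any< (a xs) λ i → P (i ∷ xs)
prᵇ-any {a = a} p q = prᵇ-ext (λ xs → natrec-cong (λ i b → cong (_∨ _) (pos-bit b)) (a xs))
  (prᵇ-natrec p (prᵇ-const false)
    (prᵇ-∨ (prᵇ-pos (pr-var (suc zero))) (prᵇ-∘ q (pr-head pr-id ∷ᵖ pr-tail (pr-tail pr-id)))))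

prᵇ-all : {a : Vec ℕ n → ℕ} {P : Vec ℕ (1 + n) → Bool} → PrimRec a → PrimRecᵇ P →
  PrimRecᵇ λ xs → all< (a xs) λ i → P (i ∷ xs)
prᵇ-all {a = a} p q = prᵇ-ext (λ xs → natrec-cong (λ i b → cong (_∧ _) (pos-bit b)) (a xs))
  (prᵇ-natrec p (prᵇ-const true)
    (prᵇ-∧ (prᵇ-pos (pr-var (suc zero))) (prᵇ-∘ q (pr-head pr-id ∷ᵖ pr-tail (pr-tail pr-id)))))

pr-pred : {a : Vec ℕ n → ℕ} → PrimRec a → PrimRec λ xs → pred (a xs)
pr-pred {a = a} p = pr-ext (λ xs → lem (a xs)) (pr-case p pr-zero (pr-var zero))
  where
  lem : ∀ x → caseℕ x 0 (λ i → i) ≡ pred x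
  lem zero    = refl
  lem (suc x) = refl

pr-+ : {a b : Vec ℕ n → ℕ} → PrimRec a → PrimRec b → PrimRec λ xs → a xs + b xs
pr-+ {a = a} p q = pr-ext (λ xs → lem (a xs)) (pr-natrec p q (pr-suc (pr-var (suc zero))))
  where
  lem : ∀ x {y} → natrec x y (λ _ r → suc r) ≡ x + y
  lem zero    = refl
  lem (suc x) = cong suc (lem x)

pr-* : {a b : Vec ℕ n → ℕ} → PrimRec a → PrimRec b → PrimRec λ xs → a xs * b xs
pr-* {a = a} p q = pr-ext (λ xs → lem (a xs))
  (pr-natrec p pr-zero (pr-+ (pr-lift (pr-lift q)) (pr-var (suc zero))))
  where
  lem : ∀ x {y} → natrec x 0 (λ _ r → y + r) ≡ x * y
  lem zero    = refl
  lem (suc x) {y} = cong (y +_) (lem x)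

pr-∸ : {a b : Vec ℕ n → ℕ} → PrimRec a → PrimRec b → PrimRec λ xs → a xs ∸ b xs
pr-∸ {b = b} p q = pr-ext (λ xs → lem _ (b xs)) (pr-natrec q p (pr-pred (pr-var (suc zero))))
  where
  lem : ∀ x y → natrec y x (λ _ r → pred r) ≡ x ∸ y
  lem x zero    = refl
  lem x (suc y) = trans (cong pred (lem x y)) (pred[m∸n]≡m∸[1+n] x y)

prᵇ-< : {a b : Vec ℕ n → ℕ} → PrimRec a → PrimRec b → PrimRecᵇ λ xs → a xs <ᵇ b xs
prᵇ-< {a = a} {b} p q = prᵇ-ext (λ xs → lem (a xs) (b xs)) (prᵇ-pos (pr-∸ q p))
  where
  lem : ∀ x y → (0 <ᵇ y ∸ x) ≡ (x <ᵇ y)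
  lem zero    y       = refl
  lem (suc x) zero    = refl
  lem (suc x) (suc y) = lem x y

prᵇ-≡ : {a b : Vec ℕ n → ℕ} → PrimRec a → PrimRec b → PrimRecᵇ λ xs → a xs ≡ᵇ b xs
prᵇ-≡ {a = a} {b} p q = prᵇ-ext (λ xs → lem (a xs) (b xs)) (prᵇ-∧ (prᵇ-not (prᵇ-< p q)) (prᵇ-not (prᵇ-< q p)))
  where
  lem : ∀ x y → not (x <ᵇ y) ∧ not (y <ᵇ x) ≡ (x ≡ᵇ y)
  lem zero    zero    = refl
  lem zero    (suc y) = refl
  lem (suc x) zero    = refl
  lem (suc x) (suc y) = lem x y

-- Bounded-search evaluation of a fixed code is primitive recursive.

enc : Maybe ℕ → ℕ
enc nothing  = 0
enc (just v) = suc v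

enc->>= : ∀ (x : Maybe ℕ) {f : ℕ → Maybe ℕ} → caseℕ (enc x) 0 (λ v → enc (f v)) ≡ enc (x >>= f)
enc->>= nothing  = refl
enc->>= (just v) = refl

-- Divergence is coded by 0 and the value `v` by `suc v`. Fuel and oracle depend on a parameter
-- vector, with the oracle primitive recursive uniformly in it, so that evaluation can be placed
-- under quantifiers over oracles.
module Simulation {m} (fuel : Vec ℕ m → ℕ) (oracle : Vec ℕ m → Oracle)
  (pr-fuel : PrimRec fuel) (prᵇ-oracle : PrimRecᵇ λ ys → oracle (tail ys) (head ys)) where

  private
    run : Vec ℕ m → ∀ {n} → Code n → Vec ℕ n → ℕ
    run ps c xs = enc (ev (fuel ps) (oracle ps) c xs)

    -- The outcome of evaluating a vector of codes is split into a convergence flag, given here, and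
    -- a vector of numbers, given by `values`, in which a divergent component has the default 0.
    converge : Vec ℕ m → ∀ {n j} → Vec (Code n) j → Vec ℕ n → ℕ
    converge ps []       xs = 1
    converge ps (h ∷ hs) xs = caseℕ (run ps h xs) 0 λ _ → converge ps hs xs

    values : Vec ℕ m → ∀ {n j} → Vec (Code n) j → Vec ℕ n → Vec ℕ j
    values ps []       xs = []
    values ps (h ∷ hs) xs = pred (run ps h xs) ∷ values ps hs xs

    enc-evs : ∀ ps {n j} (hs : Vec (Code n) j) xs {f : Vec ℕ j → Maybe ℕ} →
      caseℕ (converge ps hs xs) 0 (λ _ → enc (f (values ps hs xs))) ≡ enc (evs (fuel ps) (oracle ps) hs xs >>= f)
    enc-evs ps [] xs = refl
    enc-evs ps (h ∷ hs) xs {f} with ev (fuel ps) (oracle ps) h xs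
    ... | nothing = refl
    ... | just v with evs (fuel ps) (oracle ps) hs xs | enc-evs ps hs xs {λ ys → f (v ∷ ys)}
    ...   | nothing | e = e
    ...   | just ys | e = e

    enc-natrec : ∀ k {x} {f : ℕ → ℕ → Maybe ℕ} →
      natrec k (enc x) (λ i r → caseℕ r 0 λ v → enc (f i v)) ≡ enc (natrec k x λ i r → r >>= f i)
    enc-natrec zero    = refl
    enc-natrec (suc k) {x} {f} = trans (cong (λ r → caseℕ r 0 _) (enc-natrec k {x} {f})) (enc->>= (natrec k x λ i r → r >>= f i))

    encStep : ℕ → ℕ → ℕ → ℕ
    encStep i r e =
      caseℕ r 0 λ r′ → caseℕ r′ (caseℕ e 0 λ w → caseℕ w (suc (suc i)) λ _ → 1) λ v → suc (suc v)

    enc-step : ∀ i r x → encStep i r (enc x) ≡ scanStep i r x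
    enc-step i zero          x              = refl
    enc-step i (suc zero)    nothing        = refl
    enc-step i (suc zero)    (just zero)    = refl
    enc-step i (suc zero)    (just (suc _)) = refl
    enc-step i (suc (suc _)) x              = refl

    -- The states 0 and 1 both yield no value, and `pred` sends both to the code 0 of divergence.
    enc-found : ∀ r → pred r ≡ enc (found r)
    enc-found zero          = refl
    enc-found (suc zero)    = refl
    enc-found (suc (suc v)) = refl

  mutual
    -- Recursion on the code: each constructor of `c` is matched by a primitive recursive operation,
    -- and `mu` becomes a recursion of length `fuel` on the search state.
    pr-run : ∀ {n} (c : Code n) {k} {as : Vec ℕ k → Vec ℕ n} {ps : Vec ℕ k → Vec ℕ m} →
      PrimRecVec as → PrimRecVec ps → PrimRec λ zs → enc (ev (fuel (ps zs)) (oracle (ps zs)) c (as zs))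
    pr-run zer p q = pr-suc pr-zero
    pr-run succ {as = as} {ps} p q = pr-ext (λ zs → lem (as zs) (ps zs)) (pr-suc (pr-suc (pr-head p)))
      where
      lem : ∀ ys ps → suc (suc (head ys)) ≡ run ps succ ys
      lem (y ∷ []) ps = refl
    pr-run (proj i) p q = pr-suc (component p i)
    pr-run orc {as = as} {ps} p q =
      pr-ext (λ zs → lem (as zs) (ps zs)) (pr-suc (indicator (prᵇ-∘ prᵇ-oracle (pr-head p ∷ᵖ q))))
      where
      lem : ∀ ys ps → suc (bit (oracle ps (head ys))) ≡ run ps orc ys
      lem (y ∷ []) ps = refl
    pr-run (comp g hs) {as = as} {ps} p q = pr-ext (λ zs → enc-evs (ps zs) hs (as zs))
      (pr-case (pr-converge hs p q) pr-zero (pr-lift (pr-run g (pr-values hs p q) q)))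
    pr-run (prec g h) {as = as} {ps} p q = pr-ext (λ zs → lem (as zs) (ps zs))
      (pr-natrec (pr-head p) (pr-run g (pr-tail p) q)
        (pr-case (pr-var (suc zero)) pr-zero
          (pr-run h (pr-var (suc zero) ∷ᵖ pr-var zero ∷ᵖ pr-vec-∘ (pr-tail p) (pr-tail (pr-tail (pr-tail pr-id))))
                    (pr-vec-∘ q (pr-tail (pr-tail (pr-tail pr-id)))))))
      where
      lem : ∀ ys ps → natrec (head ys) (run ps g (tail ys)) (λ i r → caseℕ r 0 λ v → run ps h (i ∷ v ∷ tail ys)) ≡
                      run ps (prec g h) ys
      lem (y ∷ ys) ps = enc-natrec y
    pr-run (mu g) {as = as} {ps} p q = pr-ext (λ zs → lem (as zs) (ps zs))
      (pr-pred (pr-natrec (pr-∘ pr-fuel q) (pr-suc pr-zero)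
        (pr-case (pr-var (suc zero)) pr-zero
          (pr-case (pr-var zero)
            (pr-case (pr-run g (pr-var (suc zero) ∷ᵖ pr-vec-∘ p (pr-tail (pr-tail (pr-tail pr-id))))
                               (pr-vec-∘ q (pr-tail (pr-tail (pr-tail pr-id)))))
              pr-zero
              (pr-case (pr-var zero) (pr-suc (pr-suc (pr-var (suc (suc zero))))) (pr-suc pr-zero)))
            (pr-suc (pr-suc (pr-var zero)))))))
      where
      lem : ∀ ys ps → pred (natrec (fuel ps) 1 λ i r → encStep i r (run ps g (i ∷ ys))) ≡ run ps (mu g) ys
      lem ys ps = trans (cong pred (natrec-cong (λ i r → enc-step i r _) (fuel ps)))
                        (enc-found (scan (fuel ps) (oracle ps) g ys (fuel ps)))

    pr-converge : ∀ {n j} (hs : Vec (Code n) j) {k} {as : Vec ℕ k → Vec ℕ n} {ps : Vec ℕ k → Vec ℕ m} →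
      PrimRecVec as → PrimRecVec ps → PrimRec λ zs → converge (ps zs) hs (as zs)
    pr-converge []       p q = pr-suc pr-zero
    pr-converge (h ∷ hs) p q = pr-case (pr-run h p q) pr-zero (pr-lift (pr-converge hs p q))

    pr-values : ∀ {n j} (hs : Vec (Code n) j) {k} {as : Vec ℕ k → Vec ℕ n} {ps : Vec ℕ k → Vec ℕ m} →
      PrimRecVec as → PrimRecVec ps → PrimRecVec λ zs → values (ps zs) hs (as zs)
    pr-values []       p q = pr-[]
    pr-values (h ∷ hs) p q = pr-pred (pr-run h p q) ∷ᵖ pr-values hs p q

-- Bounded quantifiers, and computability of primitive recursive functions.

any<-elim : ∀ n {P} → T (any< n P) → ∃[ i ] (i < n × T (P i))
any<-elim (suc n) t with to T-∨ t
... | inj₁ t′ = let i , i<n , p = any<-elim n t′ in i , m<n⇒m<1+n i<n , p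
... | inj₂ p  = n , n<1+n n , p

any<-intro : ∀ n {P i} → i < n → T (P i) → T (any< n P)
any<-intro (suc n) {P} (s≤s i≤n) p with m≤n⇒m<n∨m≡n i≤n
... | inj₁ i<n  = from T-∨ (inj₁ (any<-intro n i<n p))
... | inj₂ refl = from (T-∨ {any< n P}) (inj₂ p)

all<-elim : ∀ n {P i} → T (all< n P) → i < n → T (P i)
all<-elim (suc n) t (s≤s i≤n) with to T-∧ t | m≤n⇒m<n∨m≡n i≤n
... | t′ , p | inj₁ i<n  = all<-elim n t′ i<n
... | t′ , p | inj₂ refl = p

all<-counterexample : ∀ n {P} → ¬ T (all< n P) → ∃[ i ] (¬ T (P i))
all<-counterexample zero    ¬t = contradiction tt ¬t
all<-counterexample (suc n) {P} ¬t with T? (P n)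
... | no ¬p = n , ¬p
... | yes p = all<-counterexample n λ t → ¬t (from T-∧ (t , p))

pr-computable : ∀ {n} {f : Vec ℕ n → ℕ} → PrimRec f → ∃[ e ] (∀ {O} xs → e ^ O ⟨ xs ⟩↓= f xs)
pr-computable (primRec e ok) = e , λ xs → ev-sound 0 _ e xs (ok 0 _ xs)

-- Finite colourings coded by digits

-- The divisor is `suc B`: the remainder counts upwards and returns to 0 after `B`, and `quo`
-- advances at exactly those moments.
rem : ℕ → ℕ → ℕ
rem B p = natrec p 0 λ _ r → if r <ᵇ B then suc r else 0

quo : ℕ → ℕ → ℕ
quo B p = natrec p 0 λ i q → if rem B i <ᵇ B then q else suc q

shift : ℕ → ℕ → ℕ → ℕ
shift B p m = natrec m p λ _ q → quo B q

-- The m-th digit of p in base 1 + B.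
digit : ℕ → ℕ → ℕ → ℕ
digit B p m = rem B (shift B p m)

-- The power of `suc B` with exponent `N`, which is the number of digit strings of length `N`.
size : ℕ → ℕ → ℕ
size B N = natrec N 1 λ _ s → s * suc B

rem-≤ : ∀ B p → rem B p ≤ B
rem-≤ B zero = z≤n
rem-≤ B (suc p) with rem B p <ᵇ B in e
... | true  = <ᵇ⇒< _ _ (from T-≡ e)
... | false = z≤n

<ᵇ-true : ∀ {m n} → m < n → (m <ᵇ n) ≡ true
<ᵇ-true m<n = to T-≡ (<⇒<ᵇ m<n)

n<ᵇn : ∀ n → (n <ᵇ n) ≡ false
n<ᵇn zero    = refl
n<ᵇn (suc n) = n<ᵇn n

-- Follows the counter: `r` grows by one until it reaches `B`, and the next number has quotient
-- `suc q` and remainder 0.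
quo-rem : ∀ B q r → r ≤ B → quo B (q * suc B + r) ≡ q × rem B (q * suc B + r) ≡ r
quo-rem B zero    zero    _ = refl , refl
quo-rem B (suc q) zero    _ with quo-rem B q B ≤-refl
... | e , e′ rewrite +-identityʳ (B + q * suc B) | +-comm B (q * suc B) | e′ | n<ᵇn B = cong suc e , refl
quo-rem B q       (suc r) r<B with quo-rem B q r (<⇒≤ r<B)
... | e , e′ rewrite +-suc (q * suc B) r | e′ | <ᵇ-true r<B = e , refl

shift-quo : ∀ B p m → shift B p (suc m) ≡ shift B (quo B p) m
shift-quo B p zero    = refl
shift-quo B p (suc m) = cong (quo B) (shift-quo B p m)

-- Horner's scheme with `a 0` as the least significant digit. It turns quantification over functions
-- on `N` points into quantification over numbers below `size B N`.
encode : ∀ B N (a : ℕ → ℕ) → (∀ m → a m ≤ B) → ∃[ p ] (p < size B N × (∀ {m} → m < N → digit B p m ≡ a m))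
encode B zero    a a≤ = 0 , z<s , λ ()
encode B (suc N) a a≤ with encode B N (a ∘ suc) (a≤ ∘ suc)
... | q , q< , ok = q * suc B + a 0 , p< , digits
  where
  open ≤-Reasoning
  p< : q * suc B + a 0 < size B N * suc B
  p< = begin-strict
    q * suc B + a 0   <⟨ +-monoʳ-< (q * suc B) (s≤s (a≤ 0)) ⟩
    q * suc B + suc B ≡⟨ +-comm (q * suc B) (suc B) ⟩
    suc q * suc B     ≤⟨ *-monoˡ-≤ (suc B) q< ⟩
    size B N * suc B  ∎
  digits : ∀ {m} → m < suc N → digit B (q * suc B + a 0) m ≡ a m
  digits {zero}  _         = proj₂ (quo-rem B q (a 0) (a≤ 0))
  digits {suc m} (s≤s m<N) = trans
    (cong (rem B) (trans (shift-quo B _ m) (cong (λ p → shift B p m) (proj₁ (quo-rem B q (a 0) (a≤ 0))))))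
    (ok m<N)

pr-rem : ∀ {n} {a b : Vec ℕ n → ℕ} → PrimRec a → PrimRec b → PrimRec λ xs → rem (a xs) (b xs)
pr-rem p q = pr-natrec q pr-zero
  (pr-if (prᵇ-< (pr-var (# 1)) (pr-lift (pr-lift p))) (pr-suc (pr-var (# 1))) pr-zero)

pr-quo : ∀ {n} {a b : Vec ℕ n → ℕ} → PrimRec a → PrimRec b → PrimRec λ xs → quo (a xs) (b xs)
pr-quo p q = pr-natrec q pr-zero
  (pr-if (prᵇ-< (pr-rem p′ (pr-var (# 0))) p′) (pr-var (# 1)) (pr-suc (pr-var (# 1))))
  where p′ = pr-lift (pr-lift p)

pr-digit : ∀ {n} {a b c : Vec ℕ n → ℕ} → PrimRec a → PrimRec b → PrimRec c →
  PrimRec λ xs → digit (a xs) (b xs) (c xs)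
pr-digit p q r = pr-rem p (pr-natrec r q (pr-quo (pr-lift (pr-lift p)) (pr-var (# 1))))

pr-size : ∀ {n} {a b : Vec ℕ n → ℕ} → PrimRec a → PrimRec b → PrimRec λ xs → size (a xs) (b xs)
pr-size p q = pr-natrec q (pr-suc pr-zero) (pr-* (pr-var (# 1)) (pr-suc (pr-lift (pr-lift p))))

-- Infinite combinatorics

Infinitely : (ℕ → Set) → Set
Infinitely P = ∀ M → ∃[ N ] (M ≤ N × P N)

decSet : {P : ℕ → Set} → Decidable P → Oracle
decSet P? y = does (P? y)

∈-decSet : {P : ℕ → Set} (P? : Decidable P) {y : ℕ} → P y → decSet P? y ≡ true
∈-decSet P? {y} p = dec-true (P? y) p

decSet-∈ : {P : ℕ → Set} (P? : Decidable P) {y : ℕ} → decSet P? y ≡ true → P y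
decSet-∈ P? {y} e with P? y
... | yes p = p

decSet-reflects : {P : ℕ → Set} (P? : Decidable P) {y : ℕ} {c : Bool} →
  (c ≡ true → P y) → (P y → c ≡ true) → c ≡ decSet P? y
decSet-reflects P? {y} {c} c⇒P P⇒c with P? y | c
... | yes p | _     = P⇒c p
... | no _  | false = refl
... | no ¬p | true  = contradiction (c⇒P refl) ¬p

decSet-infinite : {P : ℕ → Set} (P? : Decidable P) → Infinitely P → Infinite (decSet P?)
decSet-infinite P? inf M = let N , M≤N , p = inf M in N , M≤N , ∈-decSet P? p

module Classical (em : ExcludedMiddle) where

  ¬infinitely : {P : ℕ → Set} → ¬ Infinitely P → ∃[ M ] (∀ N → M ≤ N → ¬ P N)
  ¬infinitely {P} ¬inf with em (∃[ M ] (∀ N → M ≤ N → ¬ P N))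
  ... | inj₁ h = h
  ... | inj₂ ¬h = ⊥-elim (¬inf λ M → [ (λ h → h) , (λ ¬e → ⊥-elim (¬h (M , λ N M≤N p → ¬e (N , M≤N , p)))) ]′
                    (em (∃[ N ] (M ≤ N × P N))))

  -- Induction on the number of classes: if class `D` is finite, `ℓ` is raised beyond its last
  -- element. From `ℓ` on, only infinite classes are met.
  rare-die-out : (P : ℕ → ℕ → Set) (D : ℕ) → ∃[ ℓ ] (∀ {N c} → ℓ ≤ N → c < D → P c N → Infinitely (P c))
  rare-die-out P zero = 0 , λ _ ()
  rare-die-out P (suc D) with rare-die-out P D | em (Infinitely (P D))
  ... | ℓ , h | inj₁ inf = ℓ , go
    where
    go : ∀ {N c} → ℓ ≤ N → c < suc D → P c N → Infinitely (P c)
    go ℓ≤N (s≤s c≤D) p with m≤n⇒m<n∨m≡n c≤D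
    ... | inj₁ c<D  = h ℓ≤N c<D p
    ... | inj₂ refl = inf
  ... | ℓ , h | inj₂ ¬inf with ¬infinitely ¬inf
  ...   | M , none = ℓ ⊔ M , go
    where
    go : ∀ {N c} → ℓ ⊔ M ≤ N → c < suc D → P c N → Infinitely (P c)
    go ≤N (s≤s c≤D) p with m≤n⇒m<n∨m≡n c≤D
    ... | inj₁ c<D  = h (≤-trans (m≤m⊔n ℓ M) ≤N) c<D p
    ... | inj₂ refl = contradiction p (none _ (≤-trans (m≤n⊔m ℓ M) ≤N))

  -- One classified point beyond the end of all finite classes suffices, since its class must be
  -- infinite.
  pigeonhole : (P : ℕ → ℕ → Set) (D : ℕ) → Infinitely (λ N → ∃[ c ] (c < D × P c N)) → ∃[ c ] Infinitely (P c)
  pigeonhole P D inf with rare-die-out P D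
  ... | ℓ , h with inf ℓ
  ...   | N , ℓ≤N , c , c<D , p = c , h ℓ≤N c<D p

  -- The path is built through prefixes shared with good functions of arbitrarily high level. What
  -- is obtained is not goodness of the limit, but that each initial segment of it agrees with a
  -- function good at some level beyond that segment.
  module König (Good : ℕ → (ℕ → ℕ) → Set) (D : ℕ) (bounded : ∀ {N a} → Good N a → ∀ m → a m < D)
    (start : Infinitely λ N → ∃[ a ] Good N a) where

    private
      Extendible : (ℕ → ℕ) → ℕ → Set
      Extendible g n = Infinitely λ N → ∃[ a ] (Good N a × AgreeBelow n g a)

      extend : (ℕ → ℕ) → ℕ → ℕ → ℕ → ℕ
      extend g n c m with m <? n
      ... | yes _ = g m
      ... | no _  = c

      extend-below : ∀ g n c {m} → m < n → extend g n c m ≡ g m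
      extend-below g n c {m} m<n with m <? n
      ... | yes _ = refl
      ... | no m≮n = contradiction m<n m≮n

      extend-agree : ∀ g n {a} → AgreeBelow n g a → AgreeBelow (suc n) (extend g n (a n)) a
      extend-agree g n ag {y} (s≤s y≤n) with y <? n
      ... | yes y<n = ag y<n
      ... | no y≮n with m≤n⇒m<n∨m≡n y≤n
      ...   | inj₁ y<n  = contradiction y<n y≮n
      ...   | inj₂ refl = refl

      -- The good functions extending `g` take fewer than `D + 1` values at `n`, so some value
      -- recurs at arbitrarily high levels.
      step : ∀ g n → Extendible g n → ∃[ c ] Extendible (extend g n c) (suc n)
      step g n ext with pigeonhole (λ c N → ∃[ a ] (Good N a × AgreeBelow n g a × a n ≡ c)) D
        (λ M → let N , M≤N , a , good , ag = ext M in N , M≤N , a n , bounded good n , a , good , ag , refl)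
      ... | c , inf = c , λ M → let N , M≤N , a , good , ag , e = inf M in
              N , M≤N , a , good , subst (λ c → AgreeBelow (suc n) (extend g n c) a) e (extend-agree g n ag)

      prefix : ∀ n → ∃[ g ] Extendible g n
      prefix zero = (λ _ → 0) , λ M → let N , M≤N , a , good = start M in N , M≤N , a , good , λ ()
      prefix (suc n) = let g , ext = prefix n ; c , ext′ = step g n ext in extend g n c , ext′

    opaque
      limit : ℕ → ℕ
      limit n = proj₁ (prefix (suc n)) n

      prefix-limit : ∀ n → AgreeBelow n limit (proj₁ (prefix n))
      prefix-limit (suc n) {y} (s≤s y≤n) with m≤n⇒m<n∨m≡n y≤n
      ... | inj₂ refl = refl
      ... | inj₁ y<n = trans (prefix-limit n y<n) (sym (extend-below (proj₁ (prefix n)) n _ y<n))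

      limit-good : ∀ n → ∃[ N ] (n ≤ N × ∃[ a ] (Good N a × AgreeBelow n limit a))
      limit-good n = let N , n≤N , a , good , ag = proj₂ (prefix n) n in
        N , n≤N , a , good , λ y<n → trans (prefix-limit n y<n) (ag y<n)

-- The block colouring

module Blocks (Ψ : TuringFunctional) where

  Accepts : ℕ → Oracle → ℕ → Set
  Accepts s O x = ev s O Ψ (x ∷ []) ≡ just 1

  InClass : ℕ → ℕ → (ℕ → ℕ) → ℕ → ℕ → Set
  InClass b N a n y = y < N × b ≤ y × a y ≡ a n

  -- The number `N` is at once the end of the interval, a bound on `F` and the search bound. The
  -- points `x` and `x′` are outputs of the functional and need not lie in `F`.
  Split : ℕ → ℕ → (ℕ → ℕ) → Set
  Split b N a = ∃[ n ] ∃[ F ] ∃[ x ] ∃[ x′ ]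
    (b ≤ n × (∀ y → F y ≡ true → InClass b N a n y) ×
     b ≤ x × x < x′ × x′ < N × Accepts N F x × Accepts N F x′)

  -- F is replaced by a pointwise equal oracle because functions need not respect pointwise equality of oracles.
  Unsplit : ℕ → ℕ → (ℕ → ℕ) → Set
  Unsplit b N a = ∀ n (F : Oracle) x x′ → n < N → b ≤ n → (∀ y → F y ≡ true → InClass b N a n y) →
    b ≤ x → x < x′ → x′ < N → ∃[ F′ ] ((∀ y → F y ≡ F′ y) × ¬ (Accepts N F′ x × Accepts N F′ x′))

  -- The candidate `F` in coded form: the digits of `p` in base `b + 2` are the colours, and the
  -- nonzero digits of `f` select a subset of the class of `n`. The test `b <ᵇ suc y` expresses that
  -- `b ≤ y`.
  piece : ℕ → ℕ → ℕ → ℕ → ℕ → Oracle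
  piece b N p n f y =
    (y <ᵇ N) ∧ ((b <ᵇ suc y) ∧ ((digit (suc b) p y ≡ᵇ digit (suc b) p n) ∧ (0 <ᵇ digit (suc b) f y)))

  accepts : ℕ → Oracle → ℕ → Bool
  -- The number 2 is `enc (just 1)`.
  accepts s O x = enc (ev s O Ψ (x ∷ [])) ≡ᵇ 2

  splitBy : ℕ → ℕ → ℕ → ℕ → ℕ → ℕ → ℕ → Bool
  splitBy b N p n f x′ x =
    (b <ᵇ suc n) ∧ ((b <ᵇ suc x) ∧ (accepts N (piece b N p n f) x ∧ accepts N (piece b N p n f) x′))

  opaque
    -- Whether every colouring of the interval splits, with all quantifiers bounded; `p` ranges over
    -- the codes of colourings and `f` over codes of subsets.
    closes : ℕ → ℕ → Bool
    closes b N = all< (size (suc b) N) λ p → any< N λ n → any< (size (suc b) N) λ f →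
      any< N λ x′ → any< x′ λ x → splitBy b N p n f x′ x

  -- The left end of the block containing `N`. When the half-open interval from `b` to `suc i`
  -- closes, `suc i` is the first point of the next block.
  blockStart : ℕ → ℕ
  blockStart N = natrec N 0 λ i b → if closes b (suc i) then suc i else b

  sameBlock : Coloring 2
  sameBlock x y = if blockStart x ≡ᵇ blockStart y then # 1 else # 0

  -- Computability of the block colouring.

  private
    pieceOf : Vec ℕ 5 → Oracle
    pieceOf ps = piece (lookup ps (# 0)) (lookup ps (# 1)) (lookup ps (# 2)) (lookup ps (# 3)) (lookup ps (# 4))

    prᵇ-piece : PrimRecᵇ {6} λ ys → pieceOf (tail ys) (head ys)
    prᵇ-piece = prᵇ-∧ (prᵇ-< y (param (# 1))) (prᵇ-∧ (prᵇ-< (param (# 0)) (pr-suc y))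
        (prᵇ-∧ (prᵇ-≡ (digitAt (# 2) y) (digitAt (# 2) (param (# 3)))) (prᵇ-< pr-zero (digitAt (# 4) y))))
      where
      param : ∀ i → PrimRec {6} λ ys → lookup (tail ys) i
      param i = pr-lift (pr-var i)
      y : PrimRec {6} head
      y = pr-head pr-id
      digitAt : ∀ i {c} → PrimRec c → PrimRec {6} λ ys → digit (suc (lookup (tail ys) (# 0))) (lookup (tail ys) i) (c ys)
      digitAt i = pr-digit (pr-suc (param (# 0))) (param i)

    module Sim = Simulation (λ ps → lookup ps (# 1)) pieceOf (pr-var (# 1)) prᵇ-piece

    opaque
      unfolding closes

      prᵇ-closes : PrimRecᵇ {2} λ zs → closes (lookup zs (# 0)) (lookup zs (# 1))
      prᵇ-closes =
        -- Variables are numbered from the innermost quantifier outwards; in the matrix they are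
        -- `x`, `x′`, `f`, `n`, `p`, `b`, `N`.
        prᵇ-all (pr-size (pr-suc (pr-var (# 0))) (pr-var (# 1)))
          (prᵇ-any (pr-var (# 2))
            (prᵇ-any (pr-size (pr-suc (pr-var (# 2))) (pr-var (# 3)))
              (prᵇ-any (pr-var (# 4))
                (prᵇ-any (pr-var (# 0))
                  (prᵇ-∧ (prᵇ-< b (pr-suc (pr-var (# 3))))
                    (prᵇ-∧ (prᵇ-< b (pr-suc (pr-var (# 0)))) (prᵇ-∧ (acc (# 0)) (acc (# 1)))))))))
        where
        b : PrimRec {7} λ zs → lookup zs (# 5)
        b = pr-var (# 5)
        acc : ∀ i → PrimRecᵇ {7} λ zs → accepts (lookup zs (# 6))
          (piece (lookup zs (# 5)) (lookup zs (# 6)) (lookup zs (# 4)) (lookup zs (# 3)) (lookup zs (# 2))) (lookup zs i)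
        acc i = prᵇ-≡ (Sim.pr-run Ψ (pr-var i ∷ᵖ pr-[])
          (pr-var (# 5) ∷ᵖ pr-var (# 6) ∷ᵖ pr-var (# 4) ∷ᵖ pr-var (# 3) ∷ᵖ pr-var (# 2) ∷ᵖ pr-[]))
          (pr-suc (pr-suc pr-zero))

    pr-blockStart : ∀ {n} {a : Vec ℕ n → ℕ} → PrimRec a → PrimRec λ xs → blockStart (a xs)
    pr-blockStart p = pr-natrec p pr-zero
      (pr-if (prᵇ-∘ prᵇ-closes (pr-var (# 1) ∷ᵖ pr-suc (pr-var (# 0)) ∷ᵖ pr-[]))
        (pr-suc (pr-var (# 0))) (pr-var (# 1)))

    pr-sameBlock : PrimRec {2} λ zs → toℕ (sameBlock (lookup zs (# 0)) (lookup zs (# 1)))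
    pr-sameBlock = pr-ext (λ zs → lem (blockStart (lookup zs (# 0)) ≡ᵇ blockStart (lookup zs (# 1))))
      (PrimRecᵇ.indicator (prᵇ-≡ (pr-blockStart (pr-var (# 0))) (pr-blockStart (pr-var (# 1)))))
      where
      lem : ∀ b → bit b ≡ toℕ {2} (if b then # 1 else # 0)
      lem true  = refl
      lem false = refl

  sameBlock-computable : ComputableColoring sameBlock
  sameBlock-computable = let e , ok = pr-computable pr-sameBlock in e , λ x y _ → ok (x ∷ y ∷ [])

  -- What the closing test says about colourings.

  accepts-reflects : ∀ {s O x} → T (accepts s O x) → Accepts s O x
  accepts-reflects {s} {O} {x} t with ev s O Ψ (x ∷ [])
  ... | just 1 = refl

  accepts-intro : ∀ {s O x} → Accepts s O x → T (accepts s O x)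
  accepts-intro e rewrite e = tt

  opaque
    unfolding closes

    closes-split : ∀ {b N} → T (closes b N) → ∀ a → (∀ m → a m < 2 + b) → Split b N a
    closes-split {b} {N} t a a< with encode (suc b) N a (λ m → s≤s⁻¹ (a< m))
    ... | p , p< , digits with any<-elim N (all<-elim (size (suc b) N) t p<)
    ... | n , n<N , t₁ with any<-elim (size (suc b) N) t₁
    ... | f , _ , t₂ with any<-elim N t₂
    ... | x′ , x′<N , t₃ with any<-elim x′ t₃
    ... | x , x<x′ , t₄ with to (T-∧ {b <ᵇ suc n}) t₄
    ... | b≤n , t₅ with to (T-∧ {b <ᵇ suc x}) t₅
    ... | b≤x , t₆ with to (T-∧ {accepts N (piece b N p n f) x}) t₆
    ... | acc , acc′ = n , piece b N p n f , x , x′ , s≤s⁻¹ (<ᵇ⇒< b (suc n) b≤n) , inClass ,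
          s≤s⁻¹ (<ᵇ⇒< b (suc x) b≤x) , x<x′ , x′<N , accepts-reflects acc , accepts-reflects acc′
      where
      inClass : ∀ y → piece b N p n f y ≡ true → InClass b N a n y
      inClass y e with to (T-∧ {y <ᵇ N}) (from T-≡ e)
      ... | y<ᵇN , e₁ with to (T-∧ {b <ᵇ suc y}) e₁
      ... | b≤y , e₂ with <ᵇ⇒< y N y<ᵇN
      ... | y<N = y<N , s≤s⁻¹ (<ᵇ⇒< b (suc y) b≤y) ,
                  trans (sym (digits y<N)) (trans (≡ᵇ⇒≡ _ _ (proj₁ (to T-∧ e₂))) (digits n<N))

    -- The digits of a code `p` that fails the test form the colouring. A set `F` within one class
    -- is coded by its own bits, and the resulting `piece` is the pointwise equal copy `F′`.
    ¬closes-unsplit : ∀ {b N} → ¬ T (closes b N) → ∃[ a ] ((∀ m → a m < 2 + b) × Unsplit b N a)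
    ¬closes-unsplit {b} {N} ¬t with all<-counterexample (size (suc b) N) ¬t
    ... | p , ¬t₁ = a , (λ m → s≤s (rem-≤ (suc b) (shift (suc b) p m))) , unsplit
      where
      a : ℕ → ℕ
      a = digit (suc b) p
      unsplit : Unsplit b N a
      unsplit n F x x′ n<N b≤n inClass b≤x x<x′ x′<N
        with encode (suc b) N (λ y → bit (F y)) (λ y → bit-≤ (F y))
        where
        bit-≤ : ∀ c → bit c ≤ suc b
        bit-≤ true  = s≤s z≤n
        bit-≤ false = z≤n
      ... | f , f< , digits = piece b N p n f , F≗piece , λ (acc , acc′) →
            ¬t₁ (any<-intro N n<N (any<-intro (size (suc b) N) f< (any<-intro N x′<N (any<-intro x′ x<x′
              (from T-∧ (<⇒<ᵇ (s≤s b≤n) , from T-∧ (<⇒<ᵇ (s≤s b≤x) ,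
                from T-∧ (accepts-intro {O = piece b N p n f} acc , accepts-intro {O = piece b N p n f} acc′))))))))
        where
        ∈-piece : ∀ {y} → F y ≡ true → T (piece b N p n f y)
        ∈-piece {y} e with inClass y e
        ... | y<N , b≤y , a≡ = from T-∧ (<⇒<ᵇ y<N , from T-∧ (<⇒<ᵇ (s≤s b≤y) , from T-∧ (≡⇒≡ᵇ _ _ a≡ ,
                subst (λ d → T (0 <ᵇ d)) (sym (trans (digits y<N) (cong bit e))) tt)))
        piece-∈ : ∀ {y} → T (piece b N p n f y) → F y ≡ true
        piece-∈ {y} t with to (T-∧ {y <ᵇ N}) t
        ... | y<N , t′ with proj₂ (to (T-∧ {a y ≡ᵇ a n}) (proj₂ (to (T-∧ {b <ᵇ suc y}) t′)))
        ... | pos rewrite digits (<ᵇ⇒< y N y<N) with F y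
        ... | true = refl
        F≗piece : ∀ y → F y ≡ piece b N p n f y
        F≗piece y with F y in e | piece b N p n f y in e′
        ... | true  | true  = refl
        ... | false | false = refl
        ... | true  | false = trans (sym (to T-≡ (∈-piece e))) e′
        ... | false | true  = trans (sym e) (piece-∈ (from T-≡ e′))

  -- Positions of the block starts.

  blockStart-≤ : ∀ N → blockStart N ≤ N
  blockStart-≤ zero = z≤n
  blockStart-≤ (suc N) with closes (blockStart N) (suc N)
  ... | true  = ≤-refl
  ... | false = m≤n⇒m≤1+n (blockStart-≤ N)

  blockStart-closed : ∀ {N} → T (closes (blockStart N) (suc N)) → blockStart (suc N) ≡ suc N
  blockStart-closed {N} t rewrite to T-≡ t = refl

  blockStart-open : ∀ {N} → ¬ T (closes (blockStart N) (suc N)) → blockStart (suc N) ≡ blockStart N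
  blockStart-open {N} ¬t with closes (blockStart N) (suc N)
  ... | true  = contradiction tt ¬t
  ... | false = refl

  blockStart-mono : ∀ {M N} → M ≤ N → blockStart M ≤ blockStart N
  blockStart-mono {N = zero} z≤n = z≤n
  blockStart-mono {N = suc N} M≤ with m≤n⇒m<n∨m≡n M≤
  ... | inj₂ refl = ≤-refl
  ... | inj₁ (s≤s M≤N) with closes (blockStart N) (suc N)
  ...   | true  = ≤-trans (blockStart-mono M≤N) (m≤n⇒m≤1+n (blockStart-≤ N))
  ...   | false = blockStart-mono M≤N

  blockStart-within : ∀ {x N} → blockStart N ≤ x → x ≤ N → blockStart x ≡ blockStart N
  blockStart-within {N = zero} _ z≤n = refl
  blockStart-within {x} {suc N} b≤x x≤ with m≤n⇒m<n∨m≡n x≤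
  ... | inj₂ refl = refl
  ... | inj₁ (s≤s x≤N) with closes (blockStart N) (suc N)
  -- A closing here would move the start to `suc N`, beyond `x`.
  ...   | true  = contradiction b≤x (<⇒≱ (s≤s x≤N))
  ...   | false = blockStart-within b≤x x≤N

  sameBlock-≡ : ∀ x y → blockStart x ≡ blockStart y → sameBlock x y ≡ # 1
  sameBlock-≡ x y e rewrite to T-≡ (≡⇒≡ᵇ (blockStart x) (blockStart y) e) = refl

  sameBlock-≢ : ∀ x y → blockStart x ≢ blockStart y → sameBlock x y ≡ # 0
  sameBlock-≢ x y ne with blockStart x ≡ᵇ blockStart y in e
  ... | true  = contradiction (≡ᵇ⇒≡ (blockStart x) (blockStart y) (from T-≡ e)) ne
  ... | false = refl

  χ-member : ∀ {H x} → H x ≡ true → χ H x ≡ 1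
  χ-member = cong (if_then 1 else 0)

  member-χ : ∀ {H x} → χ H x ≡ 1 → H x ≡ true
  member-χ {H} {x} e with H x
  ... | true = refl

  -- The limit-homogeneous set for a given stable colouring.

  Solution : ∀ {k} → Coloring k → Set
  Solution d = ∃[ L ] (Infinite L × LimitHomogeneous d L ×
    (∀ H → Infinite H → Homogeneous sameBlock H → ¬ ComputesChar Ψ L H))

  module _ (em : ExcludedMiddle) {k} (d : Coloring k) (stable : Stable d) where
    open Classical em

    lim : ℕ → Fin k
    lim y = proj₁ (stable y)

    limit-homogeneous : ∀ {L} n → (∀ y → L y ≡ true → lim y ≡ lim n) → LimitHomogeneous d L
    limit-homogeneous n same = lim n , λ y y∈L → subst (LimitIs d y) (same y y∈L) (proj₂ (stable y))

    -- The case of a block that stays open from stage `M` on: there are unsplit colourings at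
    -- arbitrarily high levels, and König's lemma applies to them.
    module LastBlock (M b : ℕ) (unclosed : ∀ N → M ≤ N → ¬ T (closes b (suc N))) where

      Good : ℕ → (ℕ → ℕ) → Set
      Good N a = (∀ m → a m < 2 + b) × Unsplit b N a

      open König Good (2 + b) proj₁
        (λ M′ → suc (M ⊔ M′) , m≤n⇒m≤1+n (m≤n⊔m M M′) , ¬closes-unsplit (unclosed (M ⊔ M′) (m≤m⊔n M M′)))

      limit< : ∀ y → limit y < 2 + b
      limit< y = let N , _ , a , (a< , _) , ag = limit-good (suc y) in subst (_< 2 + b) (sym (ag (n<1+n y))) (a< y)

      Colored : ℕ → ℕ → ℕ → Set
      Colored i j y = toℕ (lim y) ≡ i × limit y ≡ j

      -- The pigeonhole principle is applied twice: to the limit colours of `d`, and then to the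
      -- colouring `limit` inside the infinite class obtained.
      homogeneous-for-both : ∃[ i ] ∃[ j ] Infinitely (Colored i j)
      homogeneous-for-both =
        let i , inf = pigeonhole (λ i y → toℕ (lim y) ≡ i) k (λ M → M , ≤-refl , _ , toℕ<n (lim M) , refl)
            j , inf′ = pigeonhole (Colored i) (2 + b)
                         (λ M → let y , M≤y , e = inf M in y , M≤y , _ , limit< y , e , refl)
        in i , j , inf′

      module _ (i j : ℕ) (inf : Infinitely (Colored i j)) where

        InL : ℕ → Set
        InL y = b ≤ y × Colored i j y

        inL? : Decidable InL
        inL? y = b ≤? y ×-dec (toℕ (lim y) ≟ i ×-dec limit y ≟ j)

        L : Oracle
        L = decSet inL?

        infinitely-inL : Infinitely InL
        infinitely-inL M = let y , ≤y , p = inf (b ⊔ M) in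
          y , ≤-trans (m≤n⊔m b M) ≤y , ≤-trans (m≤m⊔n b M) ≤y , p

        -- Two acceptances use only a finite part `F` of `L`. On that part `limit` agrees with an
        -- unsplit colouring `a`, so `F` lies in one class of `a` and would split it.
        ¬two-elements : ∀ {x x′ s s′} → b ≤ x → x < x′ →
          eval s L Ψ (x ∷ []) ≡ just 1 → eval s′ L Ψ (x′ ∷ []) ≡ just 1 → ⊥
        ¬two-elements {x} {x′} {s} {s′} b≤x x<x′ p p′
          with infinitely-inL 0 | ev-complete s L Ψ (x ∷ []) p | ev-complete s′ L Ψ (x′ ∷ []) p′
        ... | n , _ , b≤n , _ , n∈j | u₁ , h₁ | u₂ , h₂ with limit-good ((u₁ ⊔ u₂) ⊔ (suc n ⊔ suc x′))
        ... | N , u≤N , a , (_ , unsplit) , ag =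
              let F′ , F≗F′ , ¬acc = unsplit n F x x′ (<-≤-trans n<u u≤N) b≤n inClass b≤x x<x′ (<-≤-trans x′<u u≤N)
                  agree : AgreeBelow u L F′
                  agree {y} y<u = trans (L≗F y<u) (F≗F′ y)
              in ¬acc (h₁ N F′ (≤-trans u₁≤u u≤N) (agree-≤ {b = F′} u₁≤u agree) ,
                       h₂ N F′ (≤-trans u₂≤u u≤N) (agree-≤ {b = F′} u₂≤u agree))
          where
          u : ℕ
          -- Beyond both uses, so that `F` supports both computations, and beyond `n` and `x′`, so
          -- that both lie below `N` and `a` agrees with `limit` at `n`.
          u = (u₁ ⊔ u₂) ⊔ (suc n ⊔ suc x′)
          u₁≤u : u₁ ≤ u
          u₁≤u = ≤-trans (m≤m⊔n u₁ u₂) (m≤m⊔n _ _)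
          u₂≤u : u₂ ≤ u
          u₂≤u = ≤-trans (m≤n⊔m u₁ u₂) (m≤m⊔n _ _)
          n<u : n < u
          n<u = ≤-trans (m≤m⊔n (suc n) (suc x′)) (m≤n⊔m (u₁ ⊔ u₂) _)
          x′<u : x′ < u
          x′<u = ≤-trans (m≤n⊔m (suc n) (suc x′)) (m≤n⊔m (u₁ ⊔ u₂) _)
          inF? : Decidable λ y → InL y × y < u
          inF? y = inL? y ×-dec y <? u
          F : Oracle
          F = decSet inF?
          L≗F : AgreeBelow u L F
          L≗F {y} y<u = sym (trans (cong (L y ∧_) (dec-true (y <? u) y<u)) (∧-identityʳ (L y)))
          inClass : ∀ y → F y ≡ true → InClass b N a n y
          inClass y e with decSet-∈ inF? {y} e
          ... | (b≤y , _ , y∈j) , y<u = <-≤-trans y<u u≤N , b≤y ,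
                trans (sym (ag y<u)) (trans y∈j (trans (sym n∈j) (ag n<u)))

        solution-within : Solution d
        solution-within = L , decSet-infinite inL? infinitely-inL , limHom , notComputed
          where
          limHom : LimitHomogeneous d L
          limHom with infinitely-inL 0
          ... | n , _ , _ , n∈i , _ = limit-homogeneous n λ y e →
                toℕ-injective (trans (proj₁ (proj₂ (decSet-∈ inL? {y} e))) (sym n∈i))
          notComputed : ∀ H → Infinite H → Homogeneous sameBlock H → ¬ ComputesChar Ψ L H
          -- An infinite `H` has two elements from `b` on, and both would be accepted relative to
          -- `L`.
          notComputed H infH _ computes with infH b
          ... | x , b≤x , x∈H with infH (suc x)
          ... | x′ , x<x′ , x′∈H with computes x | computes x′
          ... | s , p | s′ , p′ = ¬two-elements {s = s} {s′} b≤x x<x′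
                (trans p (cong just (χ-member {H} x∈H))) (trans p′ (cong just (χ-member {H} x′∈H)))

      solution : Solution d
      solution = let i , j , inf = homogeneous-for-both in solution-within i j inf

    -- The bound `k ≤ blockStart N` makes the limit colours a colouring to which the closing test
    -- applies. The bound on `ℓ` makes the class of the `n` it provides infinite, as `n` is not
    -- below the block start.
    module ClosedBlock (ℓ N : ℕ) (closed : T (closes (blockStart N) (suc N)))
      (k≤ : k ≤ blockStart N) (ℓ≤ : ℓ ≤ blockStart N)
      (recurrent : ∀ {n} → ℓ ≤ n → Infinitely λ y → toℕ (lim y) ≡ toℕ (lim n)) where

      solution : Solution d
      solution with closes-split {blockStart N} {suc N} closed (toℕ ∘ lim) (λ y → <-≤-trans (toℕ<n (lim y)) (≤-trans k≤ (m≤n+m _ 2)))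
      ... | n , F , x , x′ , b≤n , F⊆ , b≤x , x<x′ , x′<N , acc , acc′
        with ev-sound (suc N) F Ψ (x ∷ []) acc | ev-sound (suc N) F Ψ (x′ ∷ []) acc′
      ... | f , p | f′ , p′ with ev-complete f F Ψ (x ∷ []) p | ev-complete f′ F Ψ (x′ ∷ []) p′
      ... | U@(u₁ , _) | U′@(u₂ , _) = L , decSet-infinite inL? infinitely-inL , limHom , notComputed
        where
        u : ℕ
        u = u₁ ⊔ u₂
        InL : ℕ → Set
        -- Below the uses `L` copies `F`, which preserves both acceptances; from `u` on it takes the
        -- whole limit-colour class of `n`, which makes it infinite.
        InL y = (y < u × F y ≡ true) ⊎ (u ≤ y × toℕ (lim y) ≡ toℕ (lim n))
        inL? : Decidable InL
        inL? y = (y <? u ×-dec F y ≟ᵇ true) ⊎-dec (u ≤? y ×-dec toℕ (lim y) ≟ toℕ (lim n))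
        L : Oracle
        L = decSet inL?
        infinitely-inL : Infinitely InL
        infinitely-inL M = let y , ≤y , e = recurrent (≤-trans ℓ≤ b≤n) (u ⊔ M) in
          y , ≤-trans (m≤n⊔m u M) ≤y , inj₂ (≤-trans (m≤m⊔n u M) ≤y , e)
        F≗L : AgreeBelow u F L
        F≗L {y} y<u = decSet-reflects inL? (λ y∈F → inj₁ (y<u , y∈F)) λ where
          (inj₁ (_ , y∈F)) → y∈F
          (inj₂ (u≤y , _)) → contradiction y<u (≤⇒≯ u≤y)
        limHom : LimitHomogeneous d L
        limHom = limit-homogeneous n λ y e → toℕ-injective (colour y (decSet-∈ inL? {y} e))
          where
          colour : ∀ y → InL y → toℕ (lim y) ≡ toℕ (lim n)
          colour y (inj₁ (_ , y∈F)) = proj₂ (proj₂ (F⊆ y y∈F))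
          colour y (inj₂ (_ , e))   = e
        within : ∀ {y} → blockStart N ≤ y → y < suc N → blockStart y ≡ blockStart N
        within b≤y (s≤s y≤N) = blockStart-within b≤y y≤N
        notComputed : ∀ H → Infinite H → Homogeneous sameBlock H → ¬ ComputesChar Ψ L H
        -- The set `H` would contain `x` and `x′` from one block, forcing colour 1, and also some
        -- `y` from a later block, forcing colour 0.
        notComputed H infH (i , hom) computes with infH (suc N)
        ... | y , N<y , y∈H = contradiction (trans (sym i≡1) i≡0) λ ()
          where
          x∈H : H x ≡ true
          x∈H = member-χ {H} (sym (eventually-unique Ψ (x ∷ []) U (agree-≤ {b = L} (m≤m⊔n u₁ u₂) F≗L) (computes x)))
          x′∈H : H x′ ≡ true
          x′∈H = member-χ {H} (sym (eventually-unique Ψ (x′ ∷ []) U′ (agree-≤ {b = L} (m≤n⊔m u₁ u₂) F≗L) (computes x′)))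
          x<y : x < y
          x<y = <-trans (<-≤-trans x<x′ (s≤s⁻¹ x′<N)) N<y
          i≡1 : i ≡ # 1
          i≡1 = trans (sym (hom x x′ x<x′ x∈H x′∈H))
            (sameBlock-≡ x x′ (trans (within b≤x (<-trans x<x′ x′<N)) (sym (within (≤-trans b≤x (<⇒≤ x<x′)) x′<N))))
          start< : blockStart x < blockStart y
          start< = begin-strict
            blockStart x       ≡⟨ within b≤x (<-trans x<x′ x′<N) ⟩
            blockStart N       ≤⟨ blockStart-≤ N ⟩
            N                  <⟨ n<1+n N ⟩
            suc N              ≡⟨ sym (blockStart-closed {N} closed) ⟩
            blockStart (suc N) ≤⟨ blockStart-mono N<y ⟩
            blockStart y       ∎
            where open ≤-Reasoning
          i≡0 : i ≡ # 0
          i≡0 = trans (sym (hom x y x<y x∈H y∈H)) (sameBlock-≢ x y (<⇒≢ start<))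

    solution : Solution d
    solution with em (Infinitely λ N → T (closes (blockStart N) (suc N)))
    ... | inj₂ ¬inf with ¬infinitely ¬inf
    ...   | M , unclosed = LastBlock.solution M (blockStart M) λ N M≤N →
              subst (λ b → ¬ T (closes b (suc N))) (constant N M≤N) (unclosed N M≤N)
      where
      constant : ∀ N → M ≤ N → blockStart N ≡ blockStart M
      constant zero    z≤n = refl
      constant (suc N) M≤ with m≤n⇒m<n∨m≡n M≤
      ... | inj₂ refl = refl
      ... | inj₁ (s≤s M≤N) = trans (blockStart-open (unclosed N M≤N)) (constant N M≤N)
    solution | inj₁ inf with rare-die-out (λ i y → toℕ (lim y) ≡ i) k
    ... | ℓ , recurrent with inf (k ⊔ ℓ)
    -- The closing at `N₀` only serves to push the block start beyond `k ⊔ ℓ`; the block used is the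
    -- one closed at the later stage `N`.
    ... | N₀ , ≤N₀ , closed₀ with inf (suc N₀)
    ... | N , N₀<N , closed = ClosedBlock.solution ℓ N closed
            (≤-trans (m≤m⊔n k ℓ) late) (≤-trans (m≤n⊔m k ℓ) late)
            (λ {n} ℓ≤n → recurrent ℓ≤n (toℕ<n (lim n)) refl)
      where
      late : k ⊔ ℓ ≤ blockStart N
      late = begin
        k ⊔ ℓ               ≤⟨ m≤n⇒m≤1+n ≤N₀ ⟩
        suc N₀              ≡⟨ sym (blockStart-closed {N₀} closed₀) ⟩
        blockStart (suc N₀) ≤⟨ blockStart-mono N₀<N ⟩
        blockStart N        ∎
        where open ≤-Reasoning

theorem3p2 : ExcludedMiddle → (Ψ : TuringFunctional) →
    ∃[ c ] (ComputableColoring {2} c ×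
    (∀ k → k ≥ 2 → (d : Coloring k) → Stable d →
    ∃[ L ] (Infinite L × LimitHomogeneous d L ×
    (∀ H → Infinite H → Homogeneous c H → ¬ ComputesChar Ψ L H))))
theorem3p2 em Ψ = sameBlock , sameBlock-computable , λ k _ d stable → solution em d stable
  where open Blocks Ψ
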